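{- Let $k\ge 1$, let $P$ be an oriented path of length $n\ge 1$ (i.e.\ with $n$ edges), and let $l=l(P)$. Then, with $c_k=8^k\cdot k!$, $$n\cdot l^{k-1}\le \mathrm{RT}(P,k)\le c_k\cdot n\cdot l^{k-1}.$$
   Context: An oriented path is a path whose edges may be oriented arbitrarily, with no bidirected edges. The length of a path is its number of edges. For an oriented path $P$, $l(P)$ denotes the length of the longest directed subpath of $P$ (a subpath all of whose edges are oriented in the same direction along the path). A tournament is an oriented graph with exactly one edge between every pair of distinct vertices. A $k$-colouring is an edge-colouring with colours $\{1,\dots,k\}$. The $k$-colour oriented Ramsey number $\mathrm{RT}(H,k)$ is the least integer $N$ such that every $k$-coloured tournament on $N$ vertices contains a monochromatic copy (not necessarily induced subgraph isomorphic as a directed graph) of $H$. -}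

module Defs where

open import Level using (0ℓ)
open import Data.Nat using (ℕ; suc; _≤_)
open import Data.Fin using (Fin; zero; suc)
open import Data.List using (List; _∷_; length; map; filter; concatMap; inits; tails)
open import Data.List.Extrema.Nat using (max)
open import Data.List.Relation.Unary.AllPairs using (AllPairs; allPairs?)
open import Data.Product using (_×_; Σ-syntax)
open import Data.Sum using (_⊎_)
open import Function.Definitions using (Injective)
open import Relation.Binary using (Rel; Asymmetric; DecidableEquality)
open import Relation.Binary.PropositionalEquality using (_≡_; _≢_; refl)
open import Relation.Nullary using (yes; no)
open import Relation.Unary using (Decidable)

-- Asymmetry excludes loops as well as bidirected edges.
record OrientedGraph (m : ℕ) : Set₁ where
  field
    _⟶_  : Rel (Fin m) 0ℓ
    asym : Asymmetric _⟶_

open OrientedGraph using () renaming (_⟶_ to Edge)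

-- With asymmetry, this gives exactly one edge on each pair of distinct vertices.
IsTournament : ∀ {m} → OrientedGraph m → Set
IsTournament T = ∀ u v → u ≢ v → Edge T u v ⊎ Edge T v u

-- The edge argument is irrelevant, so that the colour depends only on the
-- (ordered) pair of endpoints and not on the proof that they are adjacent.
Colouring : ∀ {m} → OrientedGraph m → ℕ → Set
Colouring G k = ∀ u v → .(Edge G u v) → Fin k

MonochromaticCopy : ∀ {m N k} → OrientedGraph m → (T : OrientedGraph N) → Colouring T k → Set
MonochromaticCopy {m} {N} {k} H T colour =
  Σ[ c ∈ Fin k ] Σ[ f ∈ (Fin m → Fin N) ]
    Injective _≡_ _≡_ f ×
    (∀ u v → Edge H u v → Σ[ e ∈ Edge T (f u) (f v) ] colour (f u) (f v) e ≡ c)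

Arrows : ∀ {m} → OrientedGraph m → ℕ → ℕ → Set₁
Arrows H k N =
  (T : OrientedGraph N) → IsTournament T → (colour : Colouring T k) → MonochromaticCopy H T colour

IsLeast : ∀ {a} → (ℕ → Set a) → ℕ → Set a
IsLeast Q N = Q N × (∀ M → Q M → N ≤ M)

-- IsRT H k N says that RT(H, k) exists and equals N.
IsRT : ∀ {m} → OrientedGraph m → ℕ → ℕ → Set₁
IsRT H k = IsLeast (Arrows H k)

data Direction : Set where
  forward backward : Direction

_≟_ : DecidableEquality Direction
forward  ≟ forward  = yes refl
forward  ≟ backward = no λ ()
backward ≟ forward  = no λ ()
backward ≟ backward = yes refl

-- A path with vertices 0, 1, …, n is given by the list of the directions of
-- its n edges {0,1}, {1,2}, …, {n-1,n}; its length is thus the length of the list.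
OrientedPath : Set
OrientedPath = List Direction

data PathEdge : (P : OrientedPath) → Rel (Fin (suc (length P))) 0ℓ where
  fwd   : ∀ {P} → PathEdge (forward ∷ P) zero (suc zero)
  bwd   : ∀ {P} → PathEdge (backward ∷ P) (suc zero) zero
  there : ∀ {d P u v} → PathEdge P u v → PathEdge (d ∷ P) (suc u) (suc v)

PathEdge-asym : ∀ P → Asymmetric (PathEdge P)
PathEdge-asym (_ ∷ P) (there e) (there e′) = PathEdge-asym P e e′

pathGraph : (P : OrientedPath) → OrientedGraph (suc (length P))
pathGraph P = record { _⟶_ = PathEdge P ; asym = λ {u} {v} → PathEdge-asym P {u} {v} }

subpaths : OrientedPath → List OrientedPath
subpaths P = concatMap inits (tails P)

Directed : OrientedPath → Set
Directed = AllPairs _≡_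

directed? : Decidable Directed
directed? = allPairs? _≟_

l : OrientedPath → ℕ
l P = max 0 (map length (filter directed? (subpaths P)))

{-# OPTIONS --safe #-}

-- Lower bound: on fewer than n lᵏ⁻¹ vertices, order the vertices linearly and write them
-- with one base-n digit preceded by k-1 base-l digits. Colouring an edge by its leading
-- differing digit, a directed path in one of the first k-1 colours has at most l vertices,
-- and the components of the last colour have at most n vertices.
--
-- Upper bound, by induction on k: some colour is dense, so after deleting vertices of small
-- degree there are sets A and B (not necessarily disjoint) such that in this colour every
-- vertex of A has many out-neighbours in B and every vertex of B many in-neighbours in A.
-- The maximal directed runs of P are embedded greedily, forward runs into B and backward
-- runs into A. A run of length at most l leaving v is found among the unused neighbours of
-- v: by the Gallai–Roy theorem these contain either a directed path on l vertices or a large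
-- set without edges of this colour, on which only k-1 colours remain.
module Submission where

open import Level using (0ℓ)
open import Defs hiding (_≟_)
open import Data.Bool using (Bool; true; false; _∨_; if_then_else_)
open import Data.Empty using (⊥; ⊥-elim-irr)
open import Data.Fin using (Fin; zero; suc; toℕ; punchIn; punchOut; fromℕ<)
import Data.Fin.Base as Fin
import Data.Fin.Properties as Fin
open import Data.List using (List; []; _∷_; length; map; filter; allFin; tails; inits; replicate)
open import Data.List.Extrema.Nat using (xs≤max; argmax-sel)
import Data.List.Membership.DecPropositional as DecMembership
open import Data.List.Membership.Propositional using (_∈_; _∉_; find; lose)
open import Data.List.Membership.Propositional.Properties
  using (∈-filter⁺; ∈-filter⁻; ∈-map⁺; ∈-map⁻; ∈-concatMap⁺; ∈-concatMap⁻; ∈-allFin)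
open import Data.List.Properties using (length-removeAt′; length-replicate; length-tabulate)
open import Data.List.Relation.Binary.Subset.Propositional using (_⊆_)
open import Data.List.Relation.Binary.Subset.Propositional.Properties using (filter-⊆)
open import Data.List.Relation.Unary.All as All using (All; []; _∷_)
open import Data.List.Relation.Unary.All.Properties using (─⁺; ¬Any⇒All¬; replicate⁺)
open import Data.List.Relation.Unary.AllPairs using ([]; _∷_)
open import Data.List.Relation.Unary.Any as Any using (Any; here; there; _─_)
open import Data.List.Relation.Unary.Any.Properties using (lookup-result)
open import Data.List.Relation.Unary.Linked using (Linked; [-]; _∷_)
open import Data.List.Relation.Unary.Unique.Propositional using (Unique)
open import Data.List.Relation.Unary.Unique.Propositional.Properties using (filter⁺; allFin⁺)
open import Data.Nat
open import Data.Nat.DivMod using (m≡m%n+[m/n]*n; m%n<n; /-monoˡ-≤; m<n*o⇒m/o<n)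
open import Data.Nat.ListAction using (sum)
open import Data.Nat.Properties hiding (_≟_)
open import Data.Nat.Tactic.RingSolver using (solve-∀)
open import Data.Product using (_×_; _,_; proj₁; proj₂; ∃-syntax; Σ-syntax)
open import Data.Sum as Sum using (_⊎_; inj₁; inj₂)
open import Data.Vec using (Vec; []; _∷_; lookup; tabulate)
open import Data.Vec.Properties using (lookup∘tabulate)
open import Function using (_∘_; flip)
open import Function.Definitions using (Injective)
open import Relation.Binary using (Rel; DecidableEquality; tri<; tri≈; tri>) renaming (Decidable to Decidable₂)
open import Relation.Binary.PropositionalEquality
open import Relation.Nullary using (Dec; yes; no; does; ¬_; ¬?; contradiction)
open import Relation.Nullary.Decidable using (_×-dec_; _⊎-dec_; _→-dec_; map′; dec-true; dec-false)
open import Relation.Unary using (Pred; Decidable)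

open OrientedGraph using () renaming (_⟶_ to Edge)

private variable
  A B : Set

-- Sums over lists and counting by indicator functions.

∑ : List A → (A → ℕ) → ℕ
∑ xs f = sum (map f xs)

∑-mono : ∀ (xs : List A) {f g : A → ℕ} → (∀ x → f x ≤ g x) → ∑ xs f ≤ ∑ xs g
∑-mono []       f≤g = z≤n
∑-mono (x ∷ xs) f≤g = +-mono-≤ (f≤g x) (∑-mono xs f≤g)

∑-mono-∈ : ∀ (xs : List A) {f g : A → ℕ} → (∀ {x} → x ∈ xs → f x ≤ g x) → ∑ xs f ≤ ∑ xs g
∑-mono-∈ []       f≤g = z≤n
∑-mono-∈ (x ∷ xs) f≤g = +-mono-≤ (f≤g (here refl)) (∑-mono-∈ xs (f≤g ∘ there))

∑-const : ∀ (xs : List A) c → ∑ xs (λ _ → c) ≡ length xs * c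
∑-const []       c = refl
∑-const (x ∷ xs) c = cong (c +_) (∑-const xs c)

∑-distrib-+ : ∀ (xs : List A) (f g : A → ℕ) → ∑ xs (λ x → f x + g x) ≡ ∑ xs f + ∑ xs g
∑-distrib-+ []       f g = refl
∑-distrib-+ (x ∷ xs) f g = trans (cong (f x + g x +_) (∑-distrib-+ xs f g)) (interchange (f x) (g x) (∑ xs f) (∑ xs g))
  where
  interchange : ∀ a b c d → a + b + (c + d) ≡ a + c + (b + d)
  interchange = solve-∀

∑-comm : ∀ (xs : List A) (ys : List B) (f : A → B → ℕ) →
         ∑ xs (λ x → ∑ ys (f x)) ≡ ∑ ys (λ y → ∑ xs (λ x → f x y))
∑-comm []       ys f = sym (trans (∑-const ys 0) (*-zeroʳ (length ys)))
∑-comm (x ∷ xs) ys f = trans (cong (∑ ys (f x) +_) (∑-comm xs ys f))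
                             (sym (∑-distrib-+ ys (f x) (λ y → ∑ xs (λ x → f x y))))

∑-─ : ∀ {Q : Pred A 0ℓ} {xs : List A} (f : A → ℕ) (i : Any Q xs) →
      ∑ xs f ≡ f (Any.lookup i) + ∑ (xs ─ i) f
∑-─ f (here _)          = refl
∑-─ f (there {x} {xs} i) = trans (cong (f x +_) (∑-─ f i)) (x∙yz≈y∙xz (f x) (f (Any.lookup i)) (∑ (xs ─ i) f))
  where
  x∙yz≈y∙xz : ∀ a b c → a + (b + c) ≡ b + (a + c)
  x∙yz≈y∙xz = solve-∀

term≤∑ : ∀ {xs : List A} (f : A → ℕ) {x} → x ∈ xs → f x ≤ ∑ xs f
term≤∑ f (here refl)        = m≤m+n _ _
term≤∑ f (there {y} {ys} i) = ≤-trans (term≤∑ f i) (m≤n+m (∑ ys f) (f y))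

∑-positive⇒nonempty : ∀ {f : A → ℕ} xs → 0 < ∑ xs f → ∃[ x ] x ∈ xs
∑-positive⇒nonempty (x ∷ xs) _ = x , here refl

⟦_⟧ : {P : Set} → Dec P → ℕ
⟦ p? ⟧ = if does p? then 1 else 0

⟦⟧-yes : ∀ {P : Set} (p? : Dec P) → P → ⟦ p? ⟧ ≡ 1
⟦⟧-yes (yes _) _ = refl
⟦⟧-yes (no ¬p) p = contradiction p ¬p

⟦⟧-least : ∀ {P : Set} {n} (p? : Dec P) → (P → 1 ≤ n) → ⟦ p? ⟧ ≤ n
⟦⟧-least (yes p) 1≤n = 1≤n p
⟦⟧-least (no  _) _   = z≤n

∑-⟦⟧ : ∀ {P : Pred A 0ℓ} (P? : Decidable P) xs → ∑ xs (⟦_⟧ ∘ P?) ≡ length (filter P? xs)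
∑-⟦⟧ P? []       = refl
∑-⟦⟧ P? (x ∷ xs) with does (P? x)
... | true  = cong suc (∑-⟦⟧ P? xs)
... | false = ∑-⟦⟧ P? xs

Unique-─ : ∀ {Q : Pred A 0ℓ} {xs : List A} (i : Any Q xs) → Unique xs → Unique (xs ─ i)
Unique-─ (here _)  (_ ∷ u)  = u
Unique-─ (there i) (px ∷ u) = ─⁺ i px ∷ Unique-─ i u

─-⊆ : ∀ {Q : Pred A 0ℓ} {xs : List A} (i : Any Q xs) → (xs ─ i) ⊆ xs
─-⊆ {xs = xs} i = All.lookup (─⁺ i (All.tabulate {xs = xs} (λ x∈ → x∈)))

length-─ : ∀ {Q : Pred A 0ℓ} {xs : List A} (i : Any Q xs) → length xs ≡ suc (length (xs ─ i))
length-─ {xs = xs} i = length-removeAt′ xs (Any.index i)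

length-filter-¬ : ∀ {P : Pred A 0ℓ} (P? : Decidable P) xs →
                  length (filter P? xs) + length (filter (¬? ∘ P?) xs) ≡ length xs
length-filter-¬ P? []       = refl
length-filter-¬ P? (x ∷ xs) with does (P? x)
... | true  = cong suc (length-filter-¬ P? xs)
... | false = trans (+-suc _ _) (cong suc (length-filter-¬ P? xs))

-- Degrees, edge counts and dense cores of bipartite relations.

deg : ∀ {R : A → B → Set} → (∀ x y → Dec (R x y)) → A → List B → ℕ
deg R? x ys = ∑ ys (λ y → ⟦ R? x y ⟧)

edges : ∀ {R : A → B → Set} → (∀ x y → Dec (R x y)) → List A → List B → ℕ
edges R? xs ys = ∑ xs (λ x → deg R? x ys)

-- The positive edge count makes both sides nonempty; the two degree conditions alone would also
-- hold for empty lists.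
DenseCore : ∀ {R : A → B → Set} → (∀ x y → Dec (R x y)) → ℕ → List A → List B → Set
DenseCore R? d xs ys =
  ∃[ xs′ ] ∃[ ys′ ] Unique xs′ × Unique ys′ × xs′ ⊆ xs × ys′ ⊆ ys × 0 < edges R? xs′ ys′ ×
    (∀ {x} → x ∈ xs′ → d < deg R? x ys′) × (∀ {y} → y ∈ ys′ → d < deg (flip R?) y xs′)

-- Deleting a vertex of degree at most d costs at most d edges, so the hypothesis
-- survives until every remaining vertex has degree more than d.
dense-core : ∀ {R : A → B → Set} (R? : ∀ x y → Dec (R x y)) d xs ys → Unique xs → Unique ys →
  d * (length xs + length ys) < edges R? xs ys → DenseCore R? d xs ys
dense-core {A = A} {B = B} R? d xs ys = go (length xs + length ys) xs ys ≤-refl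
  where
  drop-bound : ∀ {a b e e′ g} → a ≡ suc b → e ≡ g + e′ → g ≤ d → d * a < e → d * b < e′
  drop-bound {b = b} {e′ = e′} {g} refl refl g≤d bound =
    +-cancelˡ-< d _ _ (<-≤-trans (subst (_< g + e′) (*-suc d b) bound) (+-monoˡ-≤ e′ g≤d))

  size : ∀ xs {Q : Pred B 0ℓ} {ys} (j : Any Q ys) → length xs + length ys ≡ suc (length xs + length (ys ─ j))
  size xs j = trans (cong (length xs +_) (length-─ j)) (+-suc _ _)

  go : ∀ fuel xs ys → length xs + length ys ≤ fuel → Unique xs → Unique ys →
       d * (length xs + length ys) < edges R? xs ys → DenseCore R? d xs ys
  go fuel xs ys ≤fuel u w bound
    with Any.any? (λ x → deg R? x ys ≤? d) xs | Any.any? (λ y → deg (flip R?) y xs ≤? d) ys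
  go zero [] ys ≤fuel u w bound | yes () | _
  go (suc fuel) xs ys ≤fuel u w bound | yes i | _
    with xs′ , ys′ , u′ , w′ , xs′⊆ , rest ←
      go fuel (xs ─ i) ys (≤-pred (subst (λ a → a + length ys ≤ suc fuel) (length-─ i) ≤fuel)) (Unique-─ i u) w
        (drop-bound (cong (_+ length ys) (length-─ i)) (∑-─ (λ x → deg R? x ys) i) (lookup-result i) bound)
    = xs′ , ys′ , u′ , w′ , ─-⊆ i ∘ xs′⊆ , rest
  go zero xs ys ≤fuel u w bound | no _ | yes j =
    contradiction (subst (_≤ 0) (size xs j) ≤fuel) λ ()
  go (suc fuel) xs ys ≤fuel u w bound | no _ | yes j
    with xs′ , ys′ , u′ , w′ , xs′⊆ , ys′⊆ , rest ←
      go fuel xs (ys ─ j) (≤-pred (subst (_≤ suc fuel) (size xs j) ≤fuel)) u (Unique-─ j w)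
        -- Deleting from `ys` needs the edges counted by their endpoints in `ys`; `∑-comm` passes to
        -- that count and back.
        (subst (d * (length xs + length (ys ─ j)) <_) (∑-comm (ys ─ j) xs _)
          (drop-bound (size xs j) (trans (∑-comm xs ys _) (∑-─ (λ y → deg (flip R?) y xs) j)) (lookup-result j) bound))
    = xs′ , ys′ , u′ , w′ , xs′⊆ , ─-⊆ j ∘ ys′⊆ , rest
  go fuel xs ys ≤fuel u w bound | no ¬i | no ¬j =
    xs , ys , u , w , (λ x∈ → x∈) , (λ y∈ → y∈) , ≤-<-trans z≤n bound ,
    (λ x∈ → ≰⇒> (All.lookup (¬Any⇒All¬ xs ¬i) x∈)) , (λ y∈ → ≰⇒> (All.lookup (¬Any⇒All¬ ys ¬j) y∈))

-- Pigeonhole principles for lists.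

∈-─ : ∀ {x z : A} {xs} (i : x ∈ xs) → z ≢ x → z ∈ xs → z ∈ (xs ─ i)
∈-─ (here refl) z≢x (here refl) = contradiction refl z≢x
∈-─ (here refl) z≢x (there z∈)  = z∈
∈-─ (there i)   z≢x (here refl) = here refl
∈-─ (there i)   z≢x (there z∈)  = there (∈-─ i z≢x z∈)

Unique-⊆⇒length≤ : ∀ {xs ys : List A} → Unique xs → xs ⊆ ys → length xs ≤ length ys
Unique-⊆⇒length≤ {xs = []}     _        _  = z≤n
Unique-⊆⇒length≤ {xs = x ∷ xs} (x∉ ∷ u) xs⊆ =
  subst (suc (length xs) ≤_) (sym (length-─ (xs⊆ (here refl))))
    (s≤s (Unique-⊆⇒length≤ u λ z∈ → ∈-─ (xs⊆ (here refl)) (All.lookup x∉ z∈ ∘ sym) (xs⊆ (there z∈))))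

∑-mono-< : ∀ {xs : List A} {f g : A → ℕ} → (∀ x → f x ≤ g x) → ∀ {x} → x ∈ xs → f x < g x → ∑ xs f < ∑ xs g
∑-mono-< {xs = _ ∷ xs} f≤g (here refl) f<g = +-mono-<-≤ f<g (∑-mono xs f≤g)
∑-mono-< f≤g (there {y} x∈) f<g = +-mono-≤-< (f≤g y) (∑-mono-< f≤g x∈ f<g)

LargeClass : (A → ℕ) → ℕ → List A → Set
LargeClass f M xs = ∃[ I ] Unique I × I ⊆ xs × M < length I × ∃[ j ] (∀ {x} → x ∈ I → f x ≡ j)

-- Induction on the number of values: either the class of the top value has more than `M` elements,
-- or discarding it costs at most `M` elements and one value.
colour-class : ∀ (f : A → ℕ) t M xs → Unique xs → (∀ {x} → x ∈ xs → f x < t) → t * M < length xs →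
  LargeClass f M xs
colour-class f zero    M (x ∷ xs) u f<t large = contradiction (f<t (here refl)) λ ()
colour-class {A = A} f (suc t) M xs u f<t large = split (M <? length (filter top? xs))
  where
  top? : ∀ x → Dec (f x ≡ t)
  top? x = f x ≟ t

  rest : List A
  rest = filter (¬? ∘ top?) xs

  below-t : ∀ {x} → x ∈ rest → f x < t
  below-t x∈ with x∈xs , fx≢t ← ∈-filter⁻ (¬? ∘ top?) {xs = xs} x∈ = ≤∧≢⇒< (≤-pred (f<t x∈xs)) fx≢t

  split : Dec (M < length (filter top? xs)) → LargeClass f M xs
  split (yes M<) = filter top? xs , filter⁺ top? u , filter-⊆ top? xs , M< , t ,
    λ x∈ → proj₂ (∈-filter⁻ top? {xs = xs} x∈)
  split (no  M≮)
    with I , uI , I⊆ , class ← colour-class f t M rest (filter⁺ (¬? ∘ top?) u) below-t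
           (+-cancelˡ-< M _ _ (<-≤-trans large
             (subst (_≤ M + length rest) (length-filter-¬ top? xs) (+-monoˡ-≤ (length rest) (≮⇒≥ M≮)))))
    = I , uI , filter-⊆ (¬? ∘ top?) xs ∘ I⊆ , class

-- Arithmetic behind the constant `8 ^ k * k !`.

bound-zero : ∀ {n t} → suc t ≤ n → 2 + 4 * 1 * (n + t * 1) ≤ 8 ^ 1 * 1 ! * n * suc t ^ 0
bound-zero {n} {t} t<n = begin
  2 + 4 * 1 * (n + t * 1)    ≤⟨ m≤n+m _ 2 ⟩
  4 + 4 * 1 * (n + t * 1)    ≡⟨ lhs n t ⟩
  4 * n + 4 * suc t          ≤⟨ +-monoʳ-≤ (4 * n) (*-monoʳ-≤ 4 t<n) ⟩
  4 * n + 4 * n              ≡⟨ rhs n ⟩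
  8 * n * 1                  ∎
  where
  open ≤-Reasoning
  lhs : ∀ n t → 4 + 4 * 1 * (n + t * 1) ≡ 4 * n + 4 * suc t
  lhs = solve-∀
  rhs : ∀ n → 4 * n + 4 * n ≡ 8 * n * 1
  rhs = solve-∀

-- Shows that one more colour costs a factor `8 * suc c * suc t`. As `n ≤ suc M`, the sum
-- `n + t * M` is at most `suc t * suc M`; replacing 4 by 8 makes room for the additive 2.
bound-suc : ∀ c {n} t M → n ≤ suc M → 2 + 4 * suc c * (n + t * M) ≤ 8 * suc c * (suc t * suc M)
bound-suc c {n} t M n≤ = begin
  2 + 4 * suc c * (n + t * M)
    ≤⟨ +-mono-≤ (m≤m+n 2 (2 + 4 * c)) (*-monoʳ-≤ (4 * suc c) (+-monoˡ-≤ (t * M) n≤)) ⟩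
  4 + 4 * c + 4 * suc c * (suc M + t * M)
    ≤⟨ m≤m+n _ (4 * suc c * (2 * t + M + t * M)) ⟩
  4 + 4 * c + 4 * suc c * (suc M + t * M) + 4 * suc c * (2 * t + M + t * M)
    ≡⟨ regroup c t M ⟩
  8 * suc c * (suc t * suc M) ∎
  where
  open ≤-Reasoning
  regroup : ∀ c t M →
    4 + 4 * c + 4 * suc c * (suc M + t * M) + 4 * suc c * (2 * t + M + t * M) ≡ 8 * suc c * (suc t * suc M)
  regroup = solve-∀

-- Runs and embeddings of oriented paths.

lead : Direction → OrientedPath → ℕ
lead d []      = 0
lead d (e ∷ P) = if does (e Defs.≟ d) then suc (lead d P) else 0

-- A backward run in `R` is a forward run in the converse relation, so one argument serves both
-- directions.
along : Rel A 0ℓ → Direction → Rel A 0ℓ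
along R forward  = R
along R backward = flip R

along? : ∀ {R : Rel A 0ℓ} → Decidable₂ R → ∀ d → Decidable₂ (along R d)
along? R? forward  = R?
along? R? backward = flip R?

-- Embedding R P v X: a copy of P in R that starts at v and whose other vertices avoid X.
data Embedding (R : Rel A 0ℓ) : OrientedPath → A → List A → Set where
  []   : ∀ {v X} → Embedding R [] v X
  step : ∀ {d P v w X} → along R d v w → w ∉ v ∷ X → Embedding R P w (v ∷ X) → Embedding R (d ∷ P) v X

Copy : ∀ {k} → (Fin k → Rel A 0ℓ) → OrientedPath → Set
Copy R P = ∃[ i ] ∃[ v ] Embedding (R i) P v []

-- A bound on the longest directed subpath, phrased through leading runs of suffixes so that it
-- passes to the rest of a path by pattern matching.
RunsAtMost : ℕ → OrientedPath → Set
RunsAtMost l P = All (λ Q → ∀ d → lead d Q ≤ l) (tails P)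

opposite : Direction → Direction
opposite forward  = backward
opposite backward = forward

module Ramsey {V : Set} (_≟ⱽ_ : DecidableEquality V) where

  open DecMembership _≟ⱽ_ using (_∈?_; _∉?_)

  -- A dense colour by averaging.

  length≤-∉ : ∀ X {xs : List V} → Unique xs → length xs ≤ length X + length (filter (_∉? X) xs)
  length≤-∉ X {xs} u = subst (_≤ length X + length (filter (_∉? X) xs)) (length-filter-¬ (_∈? X) xs)
    (+-monoˡ-≤ _ (Unique-⊆⇒length≤ (filter⁺ (_∈? X) u) λ z∈ → proj₂ (∈-filter⁻ (_∈? X) {xs = xs} z∈)))

  -- What a coloured tournament provides, in a form inherited by sublists and preserved when a
  -- colour absent from them is removed.
  Covered : ∀ {k} → (Fin k → Rel V 0ℓ) → List V → Set
  Covered R S = ∀ {u v} → u ∈ S → v ∈ S → u ≢ v → ∃[ i ] (R i u v ⊎ R i v u)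

  module _ {k} {R : Fin k → Rel V 0ℓ} (R? : ∀ i → Decidable₂ (R i)) {S}
           (unique : Unique S) (covered : Covered R S) where

    private m = length S

    -- Each vertex of `S` other than `x` is joined to `x` in some colour and direction, so it
    -- contributes at least 1 to the double sum.
    degree-sum : ∀ {x} → x ∈ S → m ≤ suc (∑ (allFin k) λ i → deg (R? i) x S + deg (flip (R? i)) x S)
    degree-sum {x} x∈ = ≤-trans (length≤-∉ (x ∷ []) unique) (s≤s (begin
      length (filter (_∉? (x ∷ [])) S)                    ≡⟨ ∑-⟦⟧ (_∉? (x ∷ [])) S ⟨
      ∑ S (λ y → ⟦ y ∉? (x ∷ []) ⟧)                        ≤⟨ ∑-mono-∈ S adjacent ⟩
      ∑ S (λ y → ∑ (allFin k) λ i → a i y + b i y)         ≡⟨ ∑-comm S (allFin k) _ ⟩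
      ∑ (allFin k) (λ i → ∑ S λ y → a i y + b i y)         ≤⟨ ∑-mono (allFin k) (λ i → ≤-reflexive (∑-distrib-+ S (a i) (b i))) ⟩
      ∑ (allFin k) (λ i → deg (R? i) x S + deg (flip (R? i)) x S) ∎))
      where
      open ≤-Reasoning

      a b : Fin k → V → ℕ
      a i y = ⟦ R? i x y ⟧
      b i y = ⟦ R? i y x ⟧

      adjacent : ∀ {y} → y ∈ S → ⟦ y ∉? (x ∷ []) ⟧ ≤ ∑ (allFin k) (λ i → a i y + b i y)
      adjacent {y} y∈ = ⟦⟧-least (y ∉? (x ∷ [])) λ y∉ → 1≤ (covered x∈ y∈ (λ x≡y → y∉ (here (sym x≡y))))
        where
        1≤ : ∃[ i ] (R i x y ⊎ R i y x) → 1 ≤ ∑ (allFin k) (λ i → a i y + b i y)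
        1≤ (i , inj₁ r) = ≤-trans (≤-trans (≤-reflexive (sym (⟦⟧-yes (R? i x y) r))) (m≤m+n _ _))
                                  (term≤∑ (λ i → a i y + b i y) (∈-allFin i))
        1≤ (i , inj₂ r) = ≤-trans (≤-trans (≤-reflexive (sym (⟦⟧-yes (R? i y x) r))) (m≤n+m _ _))
                                  (term≤∑ (λ i → a i y + b i y) (∈-allFin i))

    -- If every colour had at most `d * (m + m)` edges, summing `degree-sum` over `S` would give
    -- `m * m ≤ suc (4 * k * d) * m`. The 4 is a 2 for counting out- and in-degrees times the 2 of
    -- `m + m`, the size of the two sides given to `dense-core`.
    dense-colour : ∀ d → suc (4 * k * d) < m → ∃[ i ] d * (m + m) < edges (R? i) S S
    dense-colour d large with Fin.any? (λ i → d * (m + m) <? edges (R? i) S S)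
    ... | yes dense  = dense
    ... | no  sparse = contradiction (*-cancelʳ-≤ m _ m {{>-nonZero (≤-<-trans z≤n large)}} (begin
      m * m                                                              ≡⟨ ∑-const S m ⟨
      ∑ S (λ _ → m)                                                      ≤⟨ ∑-mono-∈ S degree-sum ⟩
      ∑ S (λ x → suc (∑ (allFin k) λ i → deg⁺ i x + deg⁻ i x))            ≡⟨ ∑-distrib-+ S (λ _ → 1) _ ⟩
      ∑ S (λ _ → 1) + ∑ S (λ x → ∑ (allFin k) λ i → deg⁺ i x + deg⁻ i x)  ≡⟨ cong₂ _+_ (∑-const S 1) (∑-comm S (allFin k) _) ⟩
      m * 1 + ∑ (allFin k) (λ i → ∑ S λ x → deg⁺ i x + deg⁻ i x)          ≤⟨ +-monoʳ-≤ (m * 1) (∑-mono (allFin k) few) ⟩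
      m * 1 + ∑ (allFin k) (λ i → d * (m + m) + d * (m + m))             ≡⟨ cong (m * 1 +_) (∑-const (allFin k) _) ⟩
      m * 1 + length (allFin k) * (d * (m + m) + d * (m + m))            ≡⟨ cong (λ c → m * 1 + c * e) (length-tabulate {n = k} (λ i → i)) ⟩
      m * 1 + k * (d * (m + m) + d * (m + m))                            ≡⟨ factor m k d ⟩
      suc (4 * k * d) * m                                                ∎)) (<⇒≱ large)
      where
      open ≤-Reasoning

      e : ℕ
      e = d * (m + m) + d * (m + m)

      deg⁺ deg⁻ : Fin k → V → ℕ
      deg⁺ i x = deg (R? i) x S
      deg⁻ i x = deg (flip (R? i)) x S

      factor : ∀ m k d → m * 1 + k * (d * (m + m) + d * (m + m)) ≡ suc (4 * k * d) * m
      factor = solve-∀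

      few : ∀ i → ∑ S (λ x → deg⁺ i x + deg⁻ i x) ≤ d * (m + m) + d * (m + m)
      few i = ≤-trans (≤-reflexive (trans (∑-distrib-+ S (deg⁺ i) (deg⁻ i)) (cong (edges (R? i) S S +_) (∑-comm S S _))))
                      (+-mono-≤ e≤ e≤)
        where
        e≤ : edges (R? i) S S ≤ d * (m + m)
        e≤ = ≮⇒≥ (λ e> → sparse (i , e>))

  -- The Gallai-Roy theorem.

  module _ {R : Rel V 0ℓ} (R? : Decidable₂ R) (S : List V) where

    -- Every vertex of S at a positive level has an R-successor one level lower; the
    -- levels of a forest that cannot be raised any more are a proper colouring of R.
    record Forest : Set where
      field
        level  : V → ℕ
        parent : V → V
        parent-below : ∀ {v i} → v ∈ S → level v ≡ suc i → parent v ∈ S × R v (parent v) × level (parent v) ≡ i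

    open Forest

    module _ (F : Forest) {u v} (u∈ : u ∈ S) (v∈ : v ∈ S) (u≢v : u ≢ v) (r : R v u) (same : level F u ≡ level F v) where

      private
        -- Hanging v below u lifts v and all its descendants by one level; descends i w is meant
        -- for w at level i, so that i steps towards the root suffice to find v.
        descends : ℕ → V → Bool
        descends zero    w = does (w ≟ⱽ v)
        descends (suc i) w = does (w ≟ⱽ v) ∨ descends i (parent F w)

        raised : ℕ → V → ℕ
        raised i w = if descends i w then suc i else i

        level⁺ : V → ℕ
        level⁺ w = raised (level F w) w

        parent⁺ : V → V
        parent⁺ w = if does (w ≟ⱽ v) then u else parent F w

        raised-v : ∀ i → raised i v ≡ suc i
        raised-v zero    rewrite dec-true (v ≟ⱽ v) refl = refl
        raised-v (suc i) rewrite dec-true (v ≟ⱽ v) refl = refl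

        raised-zero : ∀ {w} → w ≢ v → raised 0 w ≡ 0
        raised-zero {w} w≢v rewrite dec-false (w ≟ⱽ v) w≢v = refl

        raised-suc : ∀ {w} i → w ≢ v → raised (suc i) w ≡ suc (raised i (parent F w))
        raised-suc {w} i w≢v rewrite dec-false (w ≟ⱽ v) w≢v with descends i (parent F w)
        ... | true  = refl
        ... | false = refl

        -- Proper descendants of `v` lie strictly above the level of `v`. In particular `u`, at the
        -- same level, is none of them, so hanging `v` below `u` closes no cycle and leaves the
        -- level of `u` unchanged.
        raised-shallow : ∀ i {w} → w ∈ S → level F w ≡ i → i ≤ level F v → w ≢ v → raised i w ≡ i
        raised-shallow zero    w∈ eq _  w≢v = raised-zero w≢v
        raised-shallow (suc i) w∈ eq i< w≢v with p∈ , _ , eq′ ← parent-below F w∈ eq =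
          trans (raised-suc i w≢v) (cong suc (raised-shallow i p∈ eq′ (<⇒≤ i<) λ p≡v →
            <⇒≢ i< (trans (sym eq′) (cong (level F) p≡v))))

        parent-below⁺ : ∀ {w i} → w ∈ S → level⁺ w ≡ suc i → parent⁺ w ∈ S × R w (parent⁺ w) × level⁺ (parent⁺ w) ≡ i
        parent-below⁺ {w} w∈ eq with w ≟ⱽ v
        ... | yes refl = u∈ , r , trans (trans (raised-shallow _ u∈ refl (≤-reflexive same) u≢v) same)
                                        (suc-injective (trans (sym (raised-v (level F v))) eq))
        ... | no w≢v = other (level F w) refl eq
          where
          other : ∀ {i} j → level F w ≡ j → raised j w ≡ suc i → parent F w ∈ S × R w (parent F w) × level⁺ (parent F w) ≡ i
          other zero    eqʷ eq = contradiction (trans (sym eq) (raised-zero w≢v)) λ ()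
          other (suc j) eqʷ eq with p∈ , r , eq′ ← parent-below F w∈ eqʷ =
            p∈ , r , trans (cong (λ l → raised l (parent F w)) eq′) (suc-injective (trans (sym (raised-suc j w≢v)) eq))

        level≤level⁺ : ∀ w → level F w ≤ level⁺ w
        level≤level⁺ w with descends (level F w) w
        ... | true  = n≤1+n _
        ... | false = ≤-refl

      raise : Σ[ F⁺ ∈ Forest ] ∑ S (level F) < ∑ S (level F⁺)
      raise = record { level = level⁺ ; parent = parent⁺ ; parent-below = parent-below⁺ } ,
              ∑-mono-< level≤level⁺ v∈ (≤-reflexive (sym (raised-v (level F v))))

    DeepForest : ℕ → Set
    DeepForest t = Σ[ F ∈ Forest ] ∃[ v ] v ∈ S × t ≤ level F v

    ProperColouring : ℕ → Set
    ProperColouring t = Σ[ f ∈ (V → ℕ) ]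
      (∀ {v} → v ∈ S → f v < t) × (∀ {u v} → u ∈ S → v ∈ S → u ≢ v → f u ≡ f v → ¬ R v u)

    -- Starting from all levels zero, raise as long as an edge of `R` joins two vertices of equal
    -- level. Each raise increases the sum of the levels, which is at most `length S * t` while no
    -- level reaches `t`; hence the fuel.
    deep-or-proper : ∀ t → DeepForest t ⊎ ProperColouring t
    deep-or-proper t = go (suc (length S * t)) flat (m≤m+n _ _)
      where
      flat : Forest
      flat = record { level = λ _ → 0 ; parent = λ v → v ; parent-below = λ _ () }

      go : ∀ fuel (F : Forest) → length S * t < fuel + ∑ S (level F) → DeepForest t ⊎ ProperColouring t
      go fuel F bound with Any.any? (λ v → t ≤? level F v) S
      ... | yes deep = inj₁ (F , find deep)
      go zero F bound | no ¬deep =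
        contradiction (≤-trans (∑-mono-∈ S (λ v∈ → <⇒≤ (≰⇒> (All.lookup (¬Any⇒All¬ S ¬deep) v∈))))
                               (≤-reflexive (∑-const S t)))
                      (<⇒≱ bound)
      go (suc fuel) F bound | no ¬deep
        with Any.any? (λ v → Any.any? (λ u → ¬? (u ≟ⱽ v) ×-dec R? v u ×-dec level F u ≟ level F v) S) S
      ... | yes conflict
        with v , v∈ , conflict′ ← find conflict
        with u , u∈ , u≢v , r , same ← find conflict′
        with F⁺ , higher ← raise F u∈ v∈ u≢v r same
        = go fuel F⁺ (<-≤-trans bound (≤-trans (≤-reflexive (sym (+-suc fuel _))) (+-monoʳ-≤ fuel higher)))
      ... | no proper =
        inj₂ (level F , (λ v∈ → ≰⇒> (All.lookup (¬Any⇒All¬ S ¬deep) v∈)) ,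
              λ u∈ v∈ u≢v same r → proper (lose v∈ (lose u∈ (u≢v , r , same))))

    -- Follow parents down to level 0. Levels strictly decrease on the way, which makes the vertices
    -- distinct.
    descent : (F : Forest) → ∀ i {v} → v ∈ S → level F v ≡ i → ∃[ cs ]
      length cs ≡ i × Linked R (v ∷ cs) × (v ∷ cs) ⊆ S × All (λ w → level F w < i) cs × Unique (v ∷ cs)
    descent F zero    v∈ eq = [] , refl , [-] , (λ { (here refl) → v∈ }) , [] , [] ∷ []
    descent F (suc i) v∈ eq
      with p∈ , r , eq′ ← parent-below F v∈ eq
      with cs , len , linked , cs⊆ , lower , u ← descent F i p∈ eq′
      = parent F _ ∷ cs , cong suc len , r ∷ linked , (λ { (here refl) → v∈ ; (there w∈) → cs⊆ w∈ }) ,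
        lower′ , All.map (λ { w< refl → <⇒≢ w< eq }) lower′ ∷ u
      where
      lower′ = s≤s (≤-reflexive eq′) ∷ All.map m<n⇒m<1+n lower

  -- Here `t` counts edges, so the chain has at least `suc t` vertices. With the edge that enters
  -- `v` it carries a run of length `suc t`.
  Chain : Rel V 0ℓ → ℕ → List V → Set
  Chain R t S = ∃[ v ] ∃[ cs ] t ≤ length cs × Linked R (v ∷ cs) × (v ∷ cs) ⊆ S × Unique (v ∷ cs)

  LargeIndependent : Rel V 0ℓ → ℕ → List V → Set
  LargeIndependent R M S = ∃[ I ] Unique I × I ⊆ S × M < length I × (∀ {u v} → u ∈ I → v ∈ I → u ≢ v → ¬ R u v)

  -- A vertex at level `t` starts a chain of parents; otherwise the levels colour `S` properly with
  -- `t` colours, and a large colour class is independent.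
  gallai-roy : ∀ {R} → Decidable₂ R → ∀ t M {S} → Unique S → t * M < length S → Chain R t S ⊎ LargeIndependent R M S
  gallai-roy R? t M {S} u large with deep-or-proper R? S t
  ... | inj₁ (F , v , v∈ , t≤) with cs , len , linked , cs⊆ , _ , uc ← descent R? S F _ v∈ refl =
    inj₁ (v , cs , ≤-trans t≤ (≤-reflexive (sym len)) , linked , cs⊆ , uc)
  ... | inj₂ (f , f<t , proper) with I , uI , I⊆ , M< , j , f≡j ← colour-class f t M S u f<t large =
    inj₂ (I , uI , I⊆ , M< , λ u∈ v∈ u≢v r →
      proper (I⊆ v∈) (I⊆ u∈) (u≢v ∘ sym) (trans (f≡j v∈) (sym (f≡j u∈))) r)

  -- Greedy embedding of the path, run by run.

  -- side d is where a run in direction d stays, so that it ends at a vertex from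
  -- which there are many ways to go on in the other direction.
  module _ {R : Rel V 0ℓ} (R? : Decidable₂ R) (n t M : ℕ) (side : Direction → List V)
           (unique : ∀ d → Unique (side d))
           (rich : ∀ {d e v} → d ≢ e → v ∈ side d → n + t * M < length (filter (along? R? e v) (side e)))
           where

    Stuck : Set
    Stuck = ∃[ e ] LargeIndependent (along R e) M (side e)

    mutual
      embed : ∀ d P {v X} cs → RunsAtMost (suc t) P → length X + length P ≤ n → v ∈ side d →
        lead d P ≤ length cs → Linked (along R d) (v ∷ cs) → cs ⊆ side d → All (_∉ v ∷ X) cs → Unique cs →
        Embedding R P v X ⊎ Stuck
      embed d [] _ _ _ _ _ _ _ _ _ = inj₁ []
      embed d (e ∷ P) {v} {X} cs (runs ∷ runs′) short v∈ lead≤ linked cs⊆ fresh u with e Defs.≟ d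
      embed d (e ∷ P) {v} {X} (c ∷ cs) (runs ∷ runs′) short v∈ (s≤s lead≤) (r ∷ linked) cs⊆ fresh u | yes refl =
        advance d P c cs runs′ short lead≤ r linked cs⊆ fresh u
      embed d (e ∷ P) cs runs short v∈ _ _ _ _ _ | no e≢d = turn e P (e≢d ∘ sym) v∈ runs short

      -- Of the more than `n + t * M` neighbours of `v` on the other side, at most `n` lie in
      -- `v ∷ X`, so more than `t * M` are left for `gallai-roy`.
      turn : ∀ {d} e P {v X} → d ≢ e → v ∈ side d → RunsAtMost (suc t) (e ∷ P) → length X + suc (length P) ≤ n →
        Embedding R (e ∷ P) v X ⊎ Stuck
      turn e P {v} {X} d≢e v∈ (runs ∷ runs′) short =
        split (gallai-roy (along? R? e) t M {filter (_∉? (v ∷ X)) nbrs} (filter⁺ (_∉? (v ∷ X)) unique-nbrs) large)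
        where
        nbrs : List V
        nbrs = filter (along? R? e v) (side e)

        unique-nbrs : Unique nbrs
        unique-nbrs = filter⁺ (along? R? e v) (unique e)

        large : t * M < length (filter (_∉? (v ∷ X)) nbrs)
        large = +-cancelˡ-< n _ _ (<-≤-trans (rich d≢e v∈) (≤-trans (length≤-∉ (v ∷ X) unique-nbrs)
                  (+-monoˡ-≤ _ (≤-trans (≤-trans (s≤s (m≤m+n _ _)) (≤-reflexive (sym (+-suc _ (length P))))) short))))

        lead-self : lead e (e ∷ P) ≡ suc (lead e P)
        lead-self rewrite dec-true (e Defs.≟ e) refl = refl

        fresh : ∀ {w} → w ∈ filter (_∉? (v ∷ X)) nbrs → w ∈ nbrs × w ∉ v ∷ X
        fresh = ∈-filter⁻ (_∉? (v ∷ X)) {xs = nbrs}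

        nbr : ∀ {w} → w ∈ nbrs → w ∈ side e × along R e v w
        nbr = ∈-filter⁻ (along? R? e v) {xs = side e}

        split : Chain (along R e) t (filter (_∉? (v ∷ X)) nbrs) ⊎
                LargeIndependent (along R e) M (filter (_∉? (v ∷ X)) nbrs) →
          Embedding R (e ∷ P) v X ⊎ Stuck
        split (inj₂ (I , uI , I⊆ , rest)) = inj₂ (e , I , uI , proj₁ ∘ nbr ∘ proj₁ ∘ fresh ∘ I⊆ , rest)
        split (inj₁ (c , cs , t≤ , linked , cs⊆ , u)) =
          -- The edge from `v` to `c` is the first of the at most `suc t` edges of the run, so `t`
          -- further edges suffice.
          advance e P c cs runs′ short (≤-trans (≤-pred (subst (_≤ suc t) lead-self (runs e))) t≤)
            (proj₂ (nbr (proj₁ (fresh (cs⊆ (here refl)))))) linked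
            (proj₁ ∘ nbr ∘ proj₁ ∘ fresh ∘ cs⊆) (All.tabulate (proj₂ ∘ fresh ∘ cs⊆)) u

      advance : ∀ e P {v X} c cs → RunsAtMost (suc t) P → length X + suc (length P) ≤ n →
        lead e P ≤ length cs → along R e v c → Linked (along R e) (c ∷ cs) → (c ∷ cs) ⊆ side e →
        All (_∉ v ∷ X) (c ∷ cs) → Unique (c ∷ cs) → Embedding R (e ∷ P) v X ⊎ Stuck
      advance e P c cs runs short lead≤ r linked cs⊆ (c∉ ∷ cs∉) (c≢ ∷ u)
        with embed e P cs runs (≤-trans (≤-reflexive (sym (+-suc _ _))) short) (cs⊆ (here refl)) lead≤ linked (cs⊆ ∘ there)
               (All.zipWith (λ { (w∉ , c≢w) (here refl) → c≢w refl ; (w∉ , c≢w) (there w∈) → w∉ w∈ }) (cs∉ , c≢)) u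
      ... | inj₁ emb   = inj₁ (step r c∉ emb)
      ... | inj₂ stuck = inj₂ stuck

  -- Induction on the number of colours.

  Forces : OrientedPath → ℕ → ℕ → Set₁
  Forces P k N = ∀ {R : Fin k → Rel V 0ℓ} → (∀ i → Decidable₂ (R i)) →
    ∀ {S} → Unique S → Covered R S → N ≤ length S → Copy R P

  forces-zero : ∀ P → Forces P 0 2
  forces-zero P R? {u ∷ v ∷ S} ((u≢v ∷ _) ∷ _) covered _ with () , _ ← covered (here refl) (there (here refl)) u≢v
  forces-zero P R? {u ∷ []} _ _ (s≤s ())

  -- Embed into the core of a dense colour `i`. Failure yields more than `M` vertices spanning no
  -- edge of colour `i`, where the hypothesis for `k` colours applies after renumbering by
  -- `punchIn i`. The bound on `N` is the strict inequality of `dense-colour` with `n + t * M` for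
  -- `d`.
  forces-suc : ∀ {d P k t M N} → RunsAtMost (suc t) (d ∷ P) → Forces (d ∷ P) k (suc M) →
    2 + 4 * suc k * (suc (length P) + t * M) ≤ N → Forces (d ∷ P) (suc k) N
  forces-suc {d} {P} {k} {t} {M} runs forces bound {R} R? {S} u covered large
    with i , dense ← dense-colour R? u covered (suc (length P) + t * M) (≤-trans bound large)
    with xs , ys , uˣ , uʸ , xs⊆ , ys⊆ , edges>0 , deg⁺> , deg⁻> ← dense-core (R? i) (suc (length P) + t * M) S S u u dense
    -- The embedding starts as if a run in the opposite direction had just ended: the reserve is
    -- empty and the first edge is a turn.
    = finish (embed (R? i) n t M side unique rich (opposite d) (d ∷ P) [] runs ≤-refl
                (proj₂ (start (opposite d))) (lead-opposite d) [-] (λ ()) [] [])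
    where
    n = suc (length P)

    side : Direction → List V
    side forward  = ys
    side backward = xs

    unique : ∀ d → Unique (side d)
    unique forward  = uʸ
    unique backward = uˣ

    rich : ∀ {d e v} → d ≢ e → v ∈ side d → n + t * M < length (filter (along? (R? i) e v) (side e))
    rich {forward}  {forward}  d≢e _ = contradiction refl d≢e
    rich {forward}  {backward} {v} _ v∈ = subst (n + t * M <_) (∑-⟦⟧ (flip (R? i) v) xs) (deg⁻> v∈)
    rich {backward} {forward}  {v} _ v∈ = subst (n + t * M <_) (∑-⟦⟧ (R? i v) ys) (deg⁺> v∈)
    rich {backward} {backward} d≢e _ = contradiction refl d≢e

    start : ∀ d → ∃[ v ] v ∈ side d
    start backward = ∑-positive⇒nonempty xs edges>0
    start forward  = ∑-positive⇒nonempty ys (≤-<-trans z≤n (deg⁺> (proj₂ (start backward))))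

    lead-opposite : ∀ d → lead (opposite d) (d ∷ P) ≤ 0
    lead-opposite forward  = z≤n
    lead-opposite backward = z≤n

    finish : ∀ {v} → Embedding (R i) (d ∷ P) v [] ⊎ Stuck (R? i) n t M side unique rich → Copy R (d ∷ P)
    finish (inj₁ copy) = i , _ , copy
    finish (inj₂ (e , I , uI , I⊆ , large , independent)) = punch (forces (R? ∘ punchIn i) uI covered′ large)
      where
      side⊆S : ∀ e → side e ⊆ S
      side⊆S forward  = ys⊆
      side⊆S backward = xs⊆

      other : ∀ e {u v} → ¬ along (R i) e u v → ¬ along (R i) e v u → ∀ j → R j u v ⊎ R j v u → i ≢ j
      other forward  ¬uv ¬vu j (inj₁ r) refl = ¬uv r
      other forward  ¬uv ¬vu j (inj₂ r) refl = ¬vu r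
      other backward ¬uv ¬vu j (inj₁ r) refl = ¬vu r
      other backward ¬uv ¬vu j (inj₂ r) refl = ¬uv r

      covered′ : Covered (R ∘ punchIn i) I
      covered′ {u} {v} u∈ v∈ u≢v with j , r ← covered (side⊆S e (I⊆ u∈)) (side⊆S e (I⊆ v∈)) u≢v =
        punchOut i≢j , subst (λ j → R j u v ⊎ R j v u) (sym (Fin.punchIn-punchOut i≢j)) r
        where
        i≢j = other e (independent u∈ v∈ u≢v) (independent v∈ u∈ (u≢v ∘ sym)) j r

      punch : Copy (R ∘ punchIn i) (d ∷ P) → Copy R (d ∷ P)
      punch (j , copy) = punchIn i j , copy

  forces-path : ∀ {d P t} → RunsAtMost (suc t) (d ∷ P) → t ≤ length P → ∀ k →
    Forces (d ∷ P) (suc k) (8 ^ suc k * suc k ! * suc (length P) * suc t ^ k)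
  forces-path {d} {P} {t} runs t≤ zero = forces-suc runs (forces-zero (d ∷ P)) (bound-zero (s≤s t≤))
  forces-path {d} {P} {t} runs t≤ (suc k) = forces-suc runs
    -- `forces-suc` expects the previous bound as a successor, so its `M` is the predecessor of the
    -- bound for one colour fewer.
    (subst (Forces (d ∷ P) (suc k)) (sym (suc-pred M)) (forces-path runs t≤ k))
    (≤-trans (bound-suc (suc k) t (pred M) (subst (n ≤_) (sym (suc-pred M)) n≤M))
             (≤-reflexive (trans (cong (λ m → 8 * suc (suc k) * (suc t * m)) (suc-pred M))
                                 (regroup (8 ^ suc k) (suc k !) n (suc t ^ k) k (suc t)))))
    where
    n = suc (length P)
    M = 8 ^ suc k * suc k ! * n * suc t ^ k

    instance
      c≢0 : NonZero (8 ^ suc k * suc k !)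
      c≢0 = m*n≢0 (8 ^ suc k) (suc k !) {{m^n≢0 8 (suc k)}} {{suc k !≢0}}

      tᵏ≢0 : NonZero (suc t ^ k)
      tᵏ≢0 = m^n≢0 (suc t) k

      M≢0 : NonZero M
      M≢0 = m*n≢0 (8 ^ suc k * suc k ! * n) (suc t ^ k) {{m*n≢0 (8 ^ suc k * suc k !) n}}

    n≤M : n ≤ M
    n≤M = ≤-trans (m≤n*m n (8 ^ suc k * suc k !)) (m≤m*n (8 ^ suc k * suc k ! * n) (suc t ^ k))

    regroup : ∀ a f n p k l → 8 * suc (suc k) * (l * (a * f * n * p)) ≡ 8 * a * (suc (suc k) * f) * n * (l * p)
    regroup = solve-∀

-- Inductive embeddings versus monochromatic copies.

vertex : ∀ {R : Rel A 0ℓ} {P v X} → Embedding R P v X → Fin (suc (length P)) → A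
vertex {v = v} _       zero    = v
vertex (step _ _ E) (suc i) = vertex E i

vertex-∉ : ∀ {R : Rel A 0ℓ} {P v X} (E : Embedding R P v X) → v ∉ X → ∀ i → vertex E i ∉ X
vertex-∉ E             v∉ zero    = v∉
vertex-∉ (step _ w∉ E) v∉ (suc i) = vertex-∉ E w∉ i ∘ there

vertex-injective : ∀ {R : Rel A 0ℓ} {P v X} (E : Embedding R P v X) → Injective _≡_ _≡_ (vertex E)
vertex-injective E             {zero}  {zero}  _  = refl
vertex-injective (step _ w∉ E) {zero}  {suc j} eq = contradiction (here (sym eq)) (vertex-∉ E w∉ j)
vertex-injective (step _ w∉ E) {suc i} {zero}  eq = contradiction (here eq) (vertex-∉ E w∉ i)
vertex-injective (step _ w∉ E) {suc i} {suc j} eq = cong suc (vertex-injective E eq)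

vertex-edge : ∀ {R : Rel A 0ℓ} {P v X} (E : Embedding R P v X) → ∀ {i j} → PathEdge P i j → R (vertex E i) (vertex E j)
vertex-edge (step r _ E) fwd       = r
vertex-edge (step r _ E) bwd       = r
vertex-edge (step _ _ E) (there e) = vertex-edge E e

embedding : ∀ {R : Rel A 0ℓ} P {X} (f : Fin (suc (length P)) → A) → Injective _≡_ _≡_ f →
  (∀ {i j} → PathEdge P i j → R (f i) (f j)) → (∀ i → f i ∉ X) → Embedding R P (f zero) X
embedding []      f inj edge f∉ = []
embedding {R = R} (d ∷ P) {X} f inj edge f∉ =
  step (first d edge) (f∉′ zero) (embedding P (f ∘ suc) (Fin.suc-injective ∘ inj) (edge ∘ there) f∉′)
  where
  first : ∀ d → (∀ {i j} → PathEdge (d ∷ P) i j → R (f i) (f j)) → along R d (f zero) (f (suc zero))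
  first forward  edge = edge fwd
  first backward edge = edge bwd

  f∉′ : ∀ i → f (suc i) ∉ f zero ∷ X
  f∉′ i (here eq)  = Fin.0≢1+n (sym (inj eq))
  f∉′ i (there f∈) = f∉ (suc i) f∈

embedding-map : ∀ {R R′ : Rel A 0ℓ} → (∀ {u v} → R u v → R′ u v) → ∀ {P v X} → Embedding R P v X → Embedding R′ P v X
embedding-map R⇒R′ []                        = []
embedding-map R⇒R′ (step {forward}  r w∉ E) = step (R⇒R′ r) w∉ (embedding-map R⇒R′ E)
embedding-map R⇒R′ (step {backward} r w∉ E) = step (R⇒R′ r) w∉ (embedding-map R⇒R′ E)

copy-map : ∀ {k P} {R R′ : Fin k → Rel A 0ℓ} → (∀ {i u v} → R i u v → R′ i u v) → Copy R P → Copy R′ P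
copy-map R⇒R′ (i , v , E) = i , v , embedding-map R⇒R′ E

-- An inductive embedding can be searched for one vertex at a time over `Fin N`, without enumerating
-- functions.
copy? : ∀ {k N} {R : Fin k → Rel (Fin N) 0ℓ} → (∀ i → Decidable₂ (R i)) → ∀ P → Dec (Copy R P)
copy? {N = N} R? P = Fin.any? λ i → Fin.any? λ v → embedding? (R? i) P v []
  where
  open DecMembership (Fin._≟_ {N}) using (_∉?_)

  embedding? : ∀ {R : Rel (Fin N) 0ℓ} → Decidable₂ R → ∀ P v X → Dec (Embedding R P v X)
  embedding? R? []      v X = yes []
  embedding? R? (d ∷ P) v X = map′ (λ (w , r , w∉ , E) → step r w∉ E) (λ { (step r w∉ E) → _ , r , w∉ , E })
    (Fin.any? λ w → along? R? d v w ×-dec w ∉? (v ∷ X) ×-dec embedding? R? P w (v ∷ X))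

ColourEdge : ∀ {N k} (T : OrientedGraph N) → Colouring T k → Fin k → Rel (Fin N) 0ℓ
ColourEdge T colour i u v = Σ[ e ∈ Edge T u v ] colour u v e ≡ i

module _ {N k} {T : OrientedGraph N} {colour : Colouring T k} {P : OrientedPath} where

  copy⇒monochromatic : Copy (ColourEdge T colour) P → MonochromaticCopy (pathGraph P) T colour
  copy⇒monochromatic (i , v , E) = i , vertex E , vertex-injective E , λ _ _ → vertex-edge E

  monochromatic⇒copy : MonochromaticCopy (pathGraph P) T colour → Copy (ColourEdge T colour) P
  monochromatic⇒copy (i , f , inj , edge) = i , f zero , embedding P f inj (λ {u} {v} → edge u v) (λ _ ())

module _ {N} {T : OrientedGraph N} (tournament : IsTournament T) where

  -- For distinct vertices `tournament` exhibits one orientation and asymmetry refutes the other.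
  edge? : Decidable₂ (Edge T)
  edge? u v with u Fin.≟ v
  ... | yes refl = no λ e → OrientedGraph.asym T e e
  ... | no  u≢v with tournament u v u≢v
  ... | inj₁ e = yes e
  ... | inj₂ e = no λ e′ → OrientedGraph.asym T e e′

  colourEdge? : ∀ {k} (colour : Colouring T k) i → Decidable₂ (ColourEdge T colour i)
  colourEdge? colour i u v with edge? u v
  ... | no ¬e = no (¬e ∘ proj₁)
  -- Colours ignore the edge proof, so testing the one proof `e` settles all of them.
  ... | yes e = map′ (e ,_) proj₂ (colour u v e Fin.≟ i)

-- Decidability of `Arrows` and existence of the least number.

Exhaustible : Set → Set₁
Exhaustible A = ∀ {P : Pred A 0ℓ} → Decidable P → Dec (∀ x → P x)

vec-exhaustible : Exhaustible A → ∀ n → Exhaustible (Vec A n)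
vec-exhaustible all-A? zero    P? = map′ (λ p → λ { [] → p }) (λ p → p []) (P? [])
vec-exhaustible all-A? (suc n) P? = map′ (λ p → λ { (x ∷ xs) → p x xs }) (λ p x xs → p (x ∷ xs))
  (all-A? λ x → vec-exhaustible all-A? n λ xs → P? (x ∷ xs))

-- A coloured tournament on N vertices is coded by a matrix; zero stands for "no edge".
Code : ℕ → ℕ → Set
Code k N = Vec (Vec (Fin (suc k)) N) N

entry : ∀ {k N} → Code k N → Fin N → Fin N → Fin (suc k)
entry c u v = lookup (lookup c u) v

CodeEdge : ∀ {k N} → Code k N → Fin k → Rel (Fin N) 0ℓ
CodeEdge c i u v = entry c u v ≡ suc i

TournamentCode : ∀ {k N} → Code k N → Set
TournamentCode c = ∀ u v →
  (entry c u v ≢ zero → ¬ entry c v u ≢ zero) ×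
  (u ≢ v → entry c u v ≢ zero ⊎ entry c v u ≢ zero)

tournamentCode? : ∀ {k N} → Decidable (TournamentCode {k} {N})
tournamentCode? c = Fin.all? λ u → Fin.all? λ v →
  (nonzero? u v →-dec ¬? (nonzero? v u)) ×-dec (¬? (u Fin.≟ v) →-dec (nonzero? u v ⊎-dec nonzero? v u))
  where
  nonzero? : ∀ u v → Dec (entry c u v ≢ zero)
  nonzero? u v = ¬? (entry c u v Fin.≟ zero)

nonzero-colour : ∀ {k} (x : Fin (suc k)) → .(x ≢ zero) → Fin k
nonzero-colour zero    x≢0 = ⊥-elim-irr (x≢0 refl)
nonzero-colour (suc i) _   = i

suc-nonzero-colour : ∀ {k} (x : Fin (suc k)) (x≢0 : x ≢ zero) → x ≡ suc (nonzero-colour x x≢0)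
suc-nonzero-colour zero    x≢0 = contradiction refl x≢0
suc-nonzero-colour (suc i) _   = refl

CodesForce : OrientedPath → ℕ → ℕ → Set
CodesForce P k N = ∀ (c : Code k N) → TournamentCode c → Copy (CodeEdge c) P

arrows⇒codes : ∀ {P k N} → Arrows (pathGraph P) k N → CodesForce P k N
arrows⇒codes {k = k} {N} arrows c valid = copy-map
  (λ {_} {u} {v} → λ { (e , refl) → suc-nonzero-colour (entry c u v) e })
  (monochromatic⇒copy {T = T} {colour} (arrows T (λ u v → proj₂ (valid u v)) colour))
  where
  T : OrientedGraph N
  T = record { _⟶_ = λ u v → entry c u v ≢ zero ; asym = λ {u} {v} → proj₁ (valid u v) }

  colour : Colouring T k
  colour u v e = nonzero-colour (entry c u v) e

codes⇒arrows : ∀ {P k N} → CodesForce P k N → Arrows (pathGraph P) k N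
codes⇒arrows {k = k} {N} force T tournament colour =
  copy⇒monochromatic {T = T} {colour} (copy-map decode (force c valid))
  where
  adjacent? : Decidable₂ (Edge T)
  adjacent? = edge? {T = T} tournament

  value : ∀ {u v} → Dec (Edge T u v) → Fin (suc k)
  value (yes e) = suc (colour _ _ e)
  value (no _)  = zero

  c : Code k N
  c = tabulate λ u → tabulate λ v → value (adjacent? u v)

  entry-c : ∀ u v → entry c u v ≡ value (adjacent? u v)
  entry-c u v = trans (cong (λ row → lookup row v) (lookup∘tabulate _ u)) (lookup∘tabulate _ v)

  value-suc : ∀ {u v i} (e? : Dec (Edge T u v)) → value e? ≡ suc i → ColourEdge T colour i u v
  value-suc (yes e) refl = e , refl

  value-nonzero : ∀ {u v} (e? : Dec (Edge T u v)) → value e? ≢ zero → Edge T u v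
  value-nonzero (yes e) _  = e
  value-nonzero (no _)  ≢0 = contradiction refl ≢0

  value-edge : ∀ {u v} (e? : Dec (Edge T u v)) → Edge T u v → value e? ≢ zero
  value-edge (yes _) _ ()
  value-edge (no ¬e) e = contradiction e ¬e

  decode : ∀ {i u v} → CodeEdge c i u v → ColourEdge T colour i u v
  decode {u = u} {v} eq = value-suc (adjacent? u v) (trans (sym (entry-c u v)) eq)

  edge : ∀ {u v} → entry c u v ≢ zero → Edge T u v
  edge {u} {v} ≢0 = value-nonzero (adjacent? u v) (≢0 ∘ trans (entry-c u v))

  edge⁻ : ∀ {u v} → Edge T u v → entry c u v ≢ zero
  edge⁻ {u} {v} e eq = value-edge (adjacent? u v) e (trans (sym (entry-c u v)) eq)

  valid : TournamentCode c
  valid u v = (λ e e′ → OrientedGraph.asym T (edge e) (edge e′)) , λ u≢v → Sum.map edge⁻ edge⁻ (tournament u v u≢v)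

-- `Arrows` ranges over arbitrary relations; through the codes only finitely many matrices have to
-- be checked. This lets `least` search for the Ramsey number.
arrows? : ∀ P k N → Dec (Arrows (pathGraph P) k N)
arrows? P k N = map′ (codes⇒arrows {P}) (arrows⇒codes {P})
  (vec-exhaustible (vec-exhaustible Fin.all? N) N λ c →
    tournamentCode? c →-dec copy? {R = CodeEdge c} (λ i u v → entry c u v Fin.≟ suc i) P)

least : ∀ {a} {Q : ℕ → Set a} → (∀ N → Dec (Q N)) → ∀ B → Q B → ∃[ N ] IsLeast Q N × N ≤ B
least {Q = Q} Q? B q = go B 0 (+-identityʳ B) (λ _ _ → z≤n)
  where
  go : ∀ d m → d + m ≡ B → (∀ M → Q M → m ≤ M) → ∃[ N ] IsLeast Q N × N ≤ B
  go d m eq lower with Q? m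
  go d       m refl lower | yes qm = m , (qm , lower) , m≤n+m m d
  go zero    m refl lower | no ¬qm = contradiction q ¬qm
  go (suc d) m eq   lower | no ¬qm = go d (suc m) (trans (+-suc d m) eq)
    λ M qM → ≤∧≢⇒< (lower M qM) λ { refl → ¬qm qM }

-- The number `l P` in terms of leading runs.

lead≤l : ∀ P {Q} → Q ∈ tails P → ∀ d → lead d Q ≤ l P
-- The directed subpath used is the leading run `replicate (lead d Q) d`, a prefix of the suffix
-- `Q`.
lead≤l P {Q} Q∈ d = subst (_≤ l P) (length-replicate (lead d Q))
  (All.lookup (xs≤max 0 _) (∈-map⁺ length (∈-filter⁺ directed?
    (∈-concatMap⁺ inits (Any.map (λ { refl → init Q }) Q∈)) (directed (lead d Q)))))
  where
  init : ∀ Q → replicate (lead d Q) d ∈ inits Q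
  init []      = here refl
  init (e ∷ Q) with e Defs.≟ d
  ... | yes refl = there (∈-map⁺ (d ∷_) (init Q))
  ... | no  _    = here refl

  directed : ∀ m → Directed (replicate m d)
  directed zero    = []
  directed (suc m) = replicate⁺ m refl ∷ directed m

runs-at-most-l : ∀ P → RunsAtMost (l P) P
runs-at-most-l P = All.tabulate (lead≤l P)

-- A longest directed subpath is a prefix of some suffix, whose leading run is then at least as
-- long.
l-attained : ∀ P → Any (λ Q → ∃[ d ] l P ≤ lead d Q) (tails P)
l-attained P with argmax-sel (λ n → n) 0 (map length (filter directed? (subpaths P)))
-- The maximum may be the default value 0 of `max`, for which any suffix and direction will do.
... | inj₁ l≡0 = here (forward , subst (_≤ lead forward P) (sym l≡0) z≤n)
... | inj₂ l∈
  with D , D∈ , l≡ ← ∈-map⁻ length l∈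
  with D∈P , directed ← ∈-filter⁻ directed? {xs = subpaths P} D∈
  = Any.map (λ {Q} D∈Q → subst (λ m → ∃[ d ] m ≤ lead d Q) (sym l≡) (length≤lead D directed D∈Q))
            (∈-concatMap⁻ inits {xs = tails P} D∈P)
  where
  init-lead : ∀ {d} D {Q} → All (d ≡_) D → D ∈ inits Q → length D ≤ lead d Q
  init-lead []       _            _  = z≤n
  init-lead {d} (.d ∷ D) {[]} (refl ∷ _) (here ())
  init-lead {d} (.d ∷ D) {[]} (refl ∷ _) (there ())
  init-lead {d} (.d ∷ D) {e ∷ Q} (refl ∷ eqs) (there D∈) with D′ , D′∈ , refl ← ∈-map⁻ (e ∷_) D∈
    rewrite dec-true (d Defs.≟ d) refl = s≤s (init-lead D eqs D′∈)

  length≤lead : ∀ D {Q} → Directed D → D ∈ inits Q → ∃[ d ] length D ≤ lead d Q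
  length≤lead []      _         _  = forward , z≤n
  length≤lead (d ∷ D) (eqs ∷ _) D∈ = d , init-lead (d ∷ D) (refl ∷ eqs) D∈

l≤length : ∀ P → l P ≤ length P
l≤length P = bounded P (l-attained P)
  where
  lead≤length : ∀ d P → lead d P ≤ length P
  lead≤length d []      = z≤n
  lead≤length d (e ∷ P) with e Defs.≟ d
  ... | yes _ = s≤s (lead≤length d P)
  ... | no  _ = z≤n

  bounded : ∀ {m} P → Any (λ Q → ∃[ d ] m ≤ lead d Q) (tails P) → m ≤ length P
  bounded P       (here (d , m≤)) = ≤-trans m≤ (lead≤length d P)
  bounded (_ ∷ P) (there i)       = m≤n⇒m≤1+n (bounded P i)

l≢0 : ∀ d P → NonZero (l (d ∷ P))
l≢0 d P = >-nonZero (≤-trans (≤-trans (s≤s z≤n) (≤-reflexive (sym lead-self))) (lead≤l (d ∷ P) (here refl) d))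
  where
  lead-self : lead d (d ∷ P) ≡ suc (lead d P)
  lead-self rewrite dec-true (d Defs.≟ d) refl = refl

-- Functions increasing along the edges of a path.

Increasing : ∀ {P} → (Fin (suc (length P)) → ℕ) → Set
Increasing {P} h = ∀ {i j} → PathEdge P i j → h i < h j

climb-up : ∀ P (h : Fin (suc (length P)) → ℕ) → Increasing {P} h → ∃[ j ] h zero + lead forward P ≤ h j
climb-up []             h inc = zero , ≤-reflexive (+-identityʳ _)
climb-up (backward ∷ P) h inc = zero , ≤-reflexive (+-identityʳ _)
climb-up (forward ∷ P)  h inc with j , h≤ ← climb-up P (h ∘ suc) (inc ∘ there) =
  suc j , ≤-trans (≤-trans (≤-reflexive (+-suc _ _)) (+-monoˡ-≤ _ (inc fwd))) h≤

climb-down : ∀ P (h : Fin (suc (length P)) → ℕ) → Increasing {P} h → ∃[ i ] h i + lead backward P ≤ h zero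
climb-down []             h inc = zero , ≤-reflexive (+-identityʳ _)
climb-down (forward ∷ P)  h inc = zero , ≤-reflexive (+-identityʳ _)
climb-down (backward ∷ P) h inc with i , h≤ ← climb-down P (h ∘ suc) (inc ∘ there) =
  suc i , ≤-trans (≤-trans (≤-reflexive (+-suc _ _)) (s≤s h≤)) (inc bwd)

climb : ∀ d P (h : Fin (suc (length P)) → ℕ) → Increasing {P} h → ∃[ i ] ∃[ j ] h i + lead d P ≤ h j
climb forward  P h inc = zero , climb-up P h inc
climb backward P h inc with i , h≤ ← climb-down P h inc = i , zero , h≤

-- Each edge of a run raises `h` by at least 1, so a run of `m` edges separates the values at its
-- ends by at least `m`.
long-increase : ∀ P (h : Fin (suc (length P)) → ℕ) → Increasing {P} h → ∀ {m} →
  Any (λ Q → ∃[ d ] m ≤ lead d Q) (tails P) → ∃[ i ] ∃[ j ] h i + m ≤ h j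
long-increase P       h inc (here (d , m≤)) with i , j , h≤ ← climb d P h inc =
  i , j , ≤-trans (+-monoʳ-≤ (h i) m≤) h≤
long-increase (_ ∷ P) h inc (there q) with i , j , h≤ ← long-increase P (h ∘ suc) (inc ∘ there) q =
  suc i , suc j , h≤

constant : ∀ P (h : Fin (suc (length P)) → ℕ) → (∀ {i j} → PathEdge P i j → h i ≡ h j) → ∀ i → h i ≡ h zero
constant P              h eq zero    = refl
constant (forward ∷ P)  h eq (suc i) = trans (constant P (h ∘ suc) (eq ∘ there) i) (sym (eq fwd))
constant (backward ∷ P) h eq (suc i) = trans (constant P (h ∘ suc) (eq ∘ there) i) (eq bwd)

-- The digit colouring and the lower bound.

colour-below : ∀ {k} {Q : Set} → Dec Q → Fin (suc k) → Fin (suc (suc k))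
colour-below (yes _) c = suc c
colour-below (no  _) c = zero

colour-below-zero : ∀ {k} {Q : Set} (q? : Dec Q) {c : Fin (suc k)} → colour-below q? c ≡ zero → ¬ Q
colour-below-zero (no ¬q) _ = ¬q

colour-below-suc : ∀ {k} {Q : Set} (q? : Dec Q) {c c′ : Fin (suc k)} → colour-below q? c ≡ suc c′ → Q × c ≡ c′
colour-below-suc (yes q) refl = q , refl

module _ (n l : ℕ) {{n≢0 : NonZero n}} {{l≢0 : NonZero l}} where

  private
    block≢0 : ∀ k → NonZero (n * l ^ k)
    block≢0 k = m*n≢0 n (l ^ k) {{n≢0}} {{m^n≢0 l k}}

    quot rem : ℕ → ℕ → ℕ
    quot k x = (x / (n * l ^ k)) {{block≢0 k}}
    rem  k x = (x % (n * l ^ k)) {{block≢0 k}}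

    divide : ∀ k x → x ≡ rem k x + quot k x * (n * l ^ k)
    divide k x = m≡m%n+[m/n]*n x (n * l ^ k) {{block≢0 k}}

    quot-mono : ∀ k {x y} → x ≤ y → quot k x ≤ quot k y
    quot-mono k = /-monoˡ-≤ (n * l ^ k) {{block≢0 k}}

    quot< : ∀ k {x} → x < n * l ^ suc k → quot k x < l
    quot< k {x} x< = m<n*o⇒m/o<n {{block≢0 k}} (subst (x <_) (shift n l (l ^ k)) x<)
      where
      shift : ∀ n l p → n * (l * p) ≡ l * (n * p)
      shift = solve-∀

  -- The colour of {x, y} is the position of the leading digit in which x and y differ,
  -- where the last digit is taken in base n and all others in base l.
  digit-colour : ∀ k → ℕ → ℕ → Fin (suc k)
  digit-colour zero    x y = zero
  digit-colour (suc k) x y = colour-below (quot k x ≟ quot k y) (digit-colour k (rem k x) (rem k y))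

  -- Induction on the number of digits. In colour `zero` the leading digit increases along every
  -- edge, yet it stays below `l` and a run has `l` edges. In a later colour it is constant on the
  -- connected path and can be stripped off. With only the last digit left, `suc n` vertices would
  -- have distinct values below `n`.
  no-copy : ∀ {P} → length P ≡ n → Any (λ Q → ∃[ d ] l ≤ lead d Q) (tails P) → ∀ k c (h : Fin (suc (length P)) → ℕ) →
    (∀ i → h i < n * l ^ k) → (∀ {i j} → h i ≡ h j → i ≡ j) → Increasing {P} h →
    (∀ {i j} → PathEdge P i j → digit-colour k (h i) (h j) ≡ c) → ⊥
  no-copy {P} refl run zero c h h< inj inc mono
    with i , j , i<j , eq ← Fin.pigeonhole ≤-refl (λ i → fromℕ< (subst (h i <_) (*-identityʳ n) (h< i)))
    = <⇒≢ i<j (cong toℕ (inj (Fin.fromℕ<-injective _ _ _ _ eq)))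
  no-copy {P} refl run (suc k) zero h h< inj inc mono
    with i , j , long ← long-increase P (quot k ∘ h)
           -- The quotient is monotone, and colour `zero` says that it differs at the two ends.
           (λ {i} {j} e → ≤∧≢⇒< (quot-mono k (<⇒≤ (inc e))) (colour-below-zero (quot k (h i) ≟ quot k (h j)) (mono e))) run
    = <⇒≱ (quot< k (h< j)) (≤-trans (m≤n+m l _) long)
  no-copy {P} refl run (suc k) (suc c) h h< inj inc mono =
    no-copy {P} refl run k c (rem k ∘ h) (λ i → m%n<n (h i) (n * l ^ k) {{block≢0 k}}) inj-rem inc-rem (proj₂ ∘ agree)
    where
    agree : ∀ {i j} → PathEdge P i j → quot k (h i) ≡ quot k (h j) × digit-colour k (rem k (h i)) (rem k (h j)) ≡ c
    agree {i} {j} e = colour-below-suc (quot k (h i) ≟ quot k (h j)) (mono e)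

    same-quot : ∀ i j → quot k (h i) ≡ quot k (h j)
    same-quot i j = trans (constant P (quot k ∘ h) (proj₁ ∘ agree) i) (sym (constant P (quot k ∘ h) (proj₁ ∘ agree) j))

    rem-mono : ∀ i j → rem k (h i) ≤ rem k (h j) → h i ≤ h j
    rem-mono i j r≤ = subst₂ _≤_ (sym (divide k (h i))) (sym (divide k (h j)))
      (+-mono-≤ r≤ (≤-reflexive (cong (_* (n * l ^ k)) (same-quot i j))))

    inj-rem : ∀ {i j} → rem k (h i) ≡ rem k (h j) → i ≡ j
    inj-rem {i} {j} r≡ = inj (≤-antisym (rem-mono i j (≤-reflexive r≡)) (rem-mono j i (≤-reflexive (sym r≡))))

    inc-rem : Increasing {P} (rem k ∘ h)
    inc-rem {i} {j} e = ≰⇒> λ r≥ → <⇒≱ (inc e) (rem-mono j i r≥)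

-- The colouring lives on the transitive tournament on `Fin N`, where `toℕ` increases along every
-- edge of a copy.
arrows⇒≥ : ∀ P {k N} {{_ : NonZero (length P)}} {{_ : NonZero (l P)}} →
  Arrows (pathGraph P) (suc k) N → length P * l P ^ k ≤ N
arrows⇒≥ P {k} {N} arrows = ≮⇒≥ λ N< → absurd N< (arrows T total colour)
  where
  T : OrientedGraph N
  T = record { _⟶_ = Fin._<_ ; asym = Fin.<-asym }

  total : IsTournament T
  total u v u≢v with Fin.<-cmp u v
  ... | tri< u<v _ _ = inj₁ u<v
  ... | tri≈ _ u≡v _ = contradiction u≡v u≢v
  ... | tri> _ _ v<u = inj₂ v<u

  colour : Colouring T (suc k)
  colour u v _ = digit-colour (length P) (l P) k (toℕ u) (toℕ v)

  absurd : N < length P * l P ^ k → ¬ MonochromaticCopy (pathGraph P) T colour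
  absurd N< (c , f , inj , edge) = no-copy (length P) (l P) refl (l-attained P) k c (toℕ ∘ f)
    (λ i → <-trans (Fin.toℕ<n (f i)) N<) (inj ∘ Fin.toℕ-injective)
    (λ {i} {j} e → proj₁ (edge i j e)) (λ {i} {j} e → proj₂ (edge i j e))

-- The upper bound for tournaments, and the theorem.

arrows-bound : ∀ k {d P t} → l (d ∷ P) ≡ suc t →
  Arrows (pathGraph (d ∷ P)) (suc k) (8 ^ suc k * suc k ! * length (d ∷ P) * suc t ^ k)
arrows-bound k {d} {P} {t} l≡ T tournament colour = copy⇒monochromatic {T = T} {colour}
  (forces-path runs t≤ k (colourEdge? {T = T} tournament colour) (allFin⁺ N) covered
    (≤-reflexive (sym (length-tabulate {n = N} (λ i → i)))))
  where
  open Ramsey Fin._≟_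

  N : ℕ
  N = 8 ^ suc k * suc k ! * length (d ∷ P) * suc t ^ k

  runs : RunsAtMost (suc t) (d ∷ P)
  runs = subst (λ m → RunsAtMost m (d ∷ P)) l≡ (runs-at-most-l (d ∷ P))

  t≤ : t ≤ length P
  t≤ = ≤-pred (subst (_≤ length (d ∷ P)) l≡ (l≤length (d ∷ P)))

  covered : Covered (ColourEdge T colour) (allFin N)
  covered {u} {v} _ _ u≢v with tournament u v u≢v
  ... | inj₁ e = colour u v e , inj₁ (e , refl)
  ... | inj₂ e = colour v u e , inj₂ (e , refl)

theorem2 : ∀ (k : ℕ) → 1 ≤ k → ∀ (P : OrientedPath) → 1 ≤ length P →
    let n = length P
        c = 8 ^ k * k !
    in ∃[ N ] (IsRT (pathGraph P) k N ×
               n * l P ^ (k ∸ 1) ≤ N ×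
               N ≤ c * n * l P ^ (k ∸ 1))
theorem2 (suc k) _ P@(d ∷ P′) _ = N , isRT , arrows⇒≥ P (proj₁ isRT) , N≤
  where
  instance
    l-nonZero : NonZero (l P)
    l-nonZero = l≢0 d P′

  bound : ℕ → ℕ
  bound m = 8 ^ suc k * suc k ! * length P * m ^ k

  arrows : Arrows (pathGraph P) (suc k) (bound (l P))
  -- `arrows-bound` takes `l P` as a successor, which it is because `P` has an edge.
  arrows = subst (λ m → Arrows (pathGraph P) (suc k) (bound m)) (suc-pred (l P))
                 (arrows-bound k (sym (suc-pred (l P))))

  RT : ∃[ N ] IsRT (pathGraph P) (suc k) N × N ≤ bound (l P)
  RT = least (arrows? P (suc k)) (bound (l P)) arrows

  N    = proj₁ RT
  isRT = proj₁ (proj₂ RT)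
  N≤   = proj₂ (proj₂ RT)
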